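{- Let $k\ge2$ and let $u_1,\dots,u_k,v_1,\dots,v_k$ be nonnegative integers with $$u_1<u_2<v_1<u_3<v_2<u_4<v_3<\dots<u_k<v_{k-1}<v_k.$$ Then $$\det F_{\mathbf u,\mathbf v}=(-y)^{\sum_{i=1}^{k-1}(v_i-u_{i+1}+1)}\,q^{\sum_{i=1}^{k-1}\left[\binom{v_i}2-\binom{u_{i+1}-1}2\right]}\cdot F_{u_2-u_1-1}(xq^{u_1},yq^{u_1},q)\,F_{v_k-v_{k-1}-1}(xq^{v_{k-1}+1},yq^{v_{k-1}+1},q)\prod_{i=1}^{k-2}F_{u_{i+2}-v_i-2}(xq^{v_i+1},yq^{v_i+1},q),$$ with the convention $F_{ -1}:=0$.
   Context: $F_n(x,y,q)=\sum_{\pi}x^{s(\pi)}y^{d(\pi)}q^{rb(\pi)}$, where: - $\pi$ ranges over layered matchings of $[n]$, i.e. set partitions whose blocks are consecutive intervals $[1,i_1]/\dots/[i_{k-1}+1,n]$ of size $1$ or $2$; - $s(\pi)$ and $d(\pi)$ are the numbers of blocks of size $1$ and $2$; - for $\pi=B_1/\dots/B_k$ with $\min B_1<\dots<\min B_k$, $rb(\pi)$ is the number of pairs $(b,B_j)$ with $b\in B_i$, $j>i$, $\max B_j>b$. Equivalently, $F_0=1$, $F_1=x$, and $F_n=xq^{n-1}F_{n-1}+yq^{n-2}F_{n-2}$ for $n\ge2$. Let $F$ be the infinite matrix with rows and columns indexed by $0,1,2,\dots$. Its $(a,b)$ entry is $F_{b-a}(xq^a,yq^a,q)$ if $b\ge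 a$ and $0$ if $b<a$. $F_{\mathbf u,\mathbf v}$ is the $k\times k$ submatrix with rows $u_1<\dots<u_k$ and columns $v_1<\dots<v_k$. $\binom{m}{2}=m(m-1)/2$. -}

module Defs where

open import Algebra.Bundles using (CommutativeRing)
open import Data.Bool.Base using (if_then_else_)
open import Data.Fin.Base using (Fin; zero; suc; toℕ; punchIn)
open import Data.Integer.Base using (ℤ; +_; -[1+_])
open import Data.List.Base using (List; []; _∷_; _∷ʳ_; _++_; foldr; map; filter; length)
open import Data.List.Extrema.Nat using (max)
open import Data.Nat.Base as ℕ using (ℕ; zero; suc; _∸_)
open import Data.Nat.ListAction using (sum)
open import Data.Nat.Properties using (_≟_; _≤?_; _<?_)
open import Relation.Nullary.Decidable using (⌊_⌋)

-- A layered matching of [n] = {1,…,n}, built by appending its last block: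
-- {n+1} (_▸single) or {n+1, n+2} (_▸double).
data LayeredMatching : ℕ → Set where
  ε        : LayeredMatching 0
  _▸single : ∀ {n} → LayeredMatching n → LayeredMatching (suc n)
  _▸double : ∀ {n} → LayeredMatching n → LayeredMatching (suc (suc n))

-- The blocks as lists of elements, in increasing order of their minima.
blocks : ∀ {n} → LayeredMatching n → List (List ℕ)
blocks ε                 = []
blocks (_▸single {n} π) = blocks π ∷ʳ (suc n ∷ [])
blocks (_▸double {n} π) = blocks π ∷ʳ (suc n ∷ suc (suc n) ∷ [])

blocksOfSize : ∀ {n} → ℕ → LayeredMatching n → ℕ
blocksOfSize m π = length (filter (λ B → length B ≟ m) (blocks π))

s d : ∀ {n} → LayeredMatching n → ℕ
s = blocksOfSize 1
d = blocksOfSize 2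

-- For B₁ ∷ … ∷ Bₖ ∷ [], the number of pairs (b , Bⱼ) with b ∈ Bᵢ, i < j and
-- b < max Bⱼ.  The 0 given to max is only the value for an empty block.
rbList : List (List ℕ) → ℕ
rbList []       = 0
rbList (B ∷ Bs) =
  sum (map (λ b → length (filter (λ B′ → b <? max 0 B′) Bs)) B) ℕ.+ rbList Bs

rb : ∀ {n} → LayeredMatching n → ℕ
rb π = rbList (blocks π)

-- Every layered matching of [n], exactly once.
layeredMatchings : ∀ n → List (LayeredMatching n)
layeredMatchings 0             = ε ∷ []
layeredMatchings 1             = ε ▸single ∷ []
layeredMatchings (suc (suc n)) =
  map _▸single (layeredMatchings (suc n)) ++ map _▸double (layeredMatchings n)

-- The indeterminates x, y, q are arbitrary elements of an arbitrary
-- commutative ring R; R = ℤ[x,y,q] gives the polynomial identities.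
module OverRing {c ℓ} (R : CommutativeRing c ℓ) where

  open CommutativeRing R public using (Carrier; _≈_; _*_; -_)
  open CommutativeRing R using (_+_; 0#; 1#; semiring; +-monoid; *-monoid)
  open import Algebra.Properties.Semiring.Exp semiring public using (_^_)
  open import Algebra.Properties.Monoid.Sum +-monoid using (sum-syntax)
  open import Algebra.Properties.Monoid.Sum *-monoid public
    using () renaming (sum to ∏)

  F : ℕ → Carrier → Carrier → Carrier → Carrier
  F n x y q =
    foldr _+_ 0# (map (λ π → x ^ s π * y ^ d π * q ^ rb π) (layeredMatchings n))

  -- F with an integer index and the convention F₋₁ = 0; below −1 the value 0
  -- is a dummy.
  Fℤ : ℤ → Carrier → Carrier → Carrier → Carrier
  Fℤ (+ n)    x y q = F n x y q
  Fℤ -[1+ _ ] x y q = 0#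

  Matrix : ℕ → Set c
  Matrix k = Fin k → Fin k → Carrier

  -- Laplace expansion along the first column.
  det : ∀ {k} → Matrix k → Carrier
  det {zero}  M = 1#
  det {suc k} M =
    ∑[ i < suc k ] ((- 1#) ^ toℕ i * M i zero * det (λ r c → M (punchIn i r) (suc c)))

  -- The infinite matrix F, rows and columns indexed by ℕ.
  FMatrix : Carrier → Carrier → Carrier → ℕ → ℕ → Carrier
  FMatrix x y q a b =
    if ⌊ a ≤? b ⌋ then F (b ∸ a) (x * q ^ a) (y * q ^ a) q else 0#

  FSubmatrix : ∀ {k} → Carrier → Carrier → Carrier → (u v : Fin k → ℕ) → Matrix k
  FSubmatrix x y q u v i j = FMatrix x y q (u i) (v j)

{-# OPTIONS --safe #-}
module Submission where

-- Write G a b for the entries of the infinite matrix.  In absolute indices they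
-- satisfy G a (n + 2) = x qⁿ⁺¹ G a (n + 1) + y qⁿ G a n for a ≤ n + 1, with
-- coefficients independent of a.  This gives Euler's continuant identity
-- G a c · G b d − G b c · G a d = ∏_{b − 1 ≤ i < c} (− y qⁱ) · G a (b − 1) · G (c + 1) d
-- for a < b ≤ c ≤ d.  By the interlacing, the first column of the submatrix has
-- only two nonzero entries.  The two minors of the Laplace expansion again have
-- interlaced indices, and by induction on k their determinants differ only in one
-- factor, G u₂ (u₃ − 1) against G u₁ (u₃ − 1), so Euler's identity with
-- d = u₃ − 1 combines them.

open import Defs
open import Algebra.Bundles using (CommutativeRing)
open import Data.Fin.Base using (Fin; zero; suc; inject₁; fromℕ)
open import Data.Integer.Base using (+_; _-_)
open import Data.Nat.Base using (ℕ; suc; _+_; _∸_; _<_)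
open import Data.Nat.Combinatorics using (_C_)
open import Data.Nat.Properties using (+-0-monoid)
open import Algebra.Properties.Monoid.Sum +-0-monoid using (sum-syntax)

import Algebra.Properties.Monoid.Sum as MonoidSum
import Algebra.Properties.Semiring.Exp as Exp
import Algebra.Solver.Ring.NaturalCoefficients.Default as Solver
open import Data.Fin.Base using (punchIn; toℕ)
import Data.Integer.Base as ℤ
import Data.Integer.Properties as ℤₚ
open import Data.List.Base using (List; []; _∷_; _∷ʳ_; _++_; foldr; map; filter; length)
open import Data.List.Extrema.Nat using (max; xs≤max)
open import Data.List.Properties using (filter-++; length-++; map-++; filter-all)
open import Data.List.Relation.Unary.All as All using (All; []; _∷_)
open import Data.List.Relation.Unary.All.Properties using (++⁺)
open import Data.Nat.Base using (zero; _≤_; z≤n; s≤s; _≤′_; ≤′-refl; ≤′-step)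
open import Data.Nat.Combinatorics using (nC1≡n; nCk+nC[k+1]≡[n+1]C[k+1])
open import Data.Nat.ListAction using (sum)
open import Data.Nat.ListAction.Properties using (sum-++)
open import Data.Nat.Properties as ℕₚ using (_≟_; _<?_; _≤?_)
open import Data.Product.Base using (_×_; _,_; proj₁)
open import Data.Sum.Base using (inj₁; inj₂)
open import Function.Base using (_∘_)
open import Level using (Level)
open import Relation.Binary.PropositionalEquality as ≡ using (_≡_; refl; cong; cong₂)
import Relation.Binary.Reasoning.Setoid as SetoidReasoning
open import Relation.Nullary using (yes; no; contradiction)
open import Relation.Unary using (Decidable)

private
  variable
    a : Level
    A : Set a
    n : ℕ

-- Block statistics after appending a last block.

length-filter-∷ʳ : ∀ {p} {P : A → Set p} (P? : Decidable P) xs x →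
  length (filter P? (xs ∷ʳ x)) ≡ length (filter P? xs) + length (filter P? (x ∷ []))
length-filter-∷ʳ P? xs x =
  ≡.trans (cong length (filter-++ P? xs (x ∷ []))) (length-++ (filter P? xs))

sum-map-+1 : ∀ (f g : ℕ → ℕ) {bs} → All (λ b → f b ≡ suc (g b)) bs →
  sum (map f bs) ≡ sum (map g bs) + length bs
sum-map-+1 f g []                           = refl
sum-map-+1 f g (_∷_ {x = b} {xs = bs} fb≡ rest) = begin
  f b + sum (map f bs)                      ≡⟨ cong₂ _+_ fb≡ (sum-map-+1 f g rest) ⟩
  suc (g b) + (sum (map g bs) + length bs)  ≡⟨ ℕₚ.+-assoc (suc (g b)) _ _ ⟨
  suc (g b) + sum (map g bs) + length bs    ≡⟨ ℕₚ.+-suc (g b + sum (map g bs)) (length bs) ⟨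
  g b + sum (map g bs) + suc (length bs)    ∎
  where open ≡.≡-Reasoning

rbList-[_] : ∀ B → rbList (B ∷ []) ≡ 0
rbList-[ []    ] = refl
rbList-[ b ∷ B ] = rbList-[ B ]

-- Each element of an earlier block lies below the maximum of `B`, so it forms exactly one new pair;
-- `B`, being last, has no later block to pair with.
rbList-∷ʳ : ∀ {Bs} B → All (All (_< max 0 B)) Bs →
  rbList (Bs ∷ʳ B) ≡ rbList Bs + sum (map length Bs)
rbList-∷ʳ B [] = rbList-[ B ]
rbList-∷ʳ B (_∷_ {x = B₀} {xs = Bs} B₀<B Bs<B) = begin
  sum (map (count (Bs ∷ʳ B)) B₀) + rbList (Bs ∷ʳ B)
    ≡⟨ cong₂ _+_ (sum-map-+1 (count (Bs ∷ʳ B)) (count Bs) (All.map count-∷ʳ B₀<B)) (rbList-∷ʳ B Bs<B) ⟩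
  (sum (map (count Bs) B₀) + length B₀) + (rbList Bs + sum (map length Bs))
    ≡⟨ interchange (sum (map (count Bs) B₀)) (length B₀) (rbList Bs) _ ⟩
  (sum (map (count Bs) B₀) + rbList Bs) + (length B₀ + sum (map length Bs)) ∎
  where
  open ≡.≡-Reasoning
  open import Algebra.Properties.CommutativeSemigroup ℕₚ.+-commutativeSemigroup using (interchange)
  count : List (List ℕ) → ℕ → ℕ
  count Cs b = length (filter (λ B′ → b <? max 0 B′) Cs)
  count-∷ʳ : ∀ {b} → b < max 0 B → count (Bs ∷ʳ B) b ≡ suc (count Bs b)
  count-∷ʳ {b} b<B = begin
    count (Bs ∷ʳ B) b
      ≡⟨ length-filter-∷ʳ (λ B′ → b <? max 0 B′) Bs B ⟩
    count Bs b + count (B ∷ []) b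
      ≡⟨ cong (λ Cs → count Bs b + length Cs) (filter-all (λ B′ → b <? max 0 B′) {B ∷ []} (b<B ∷ [])) ⟩
    count Bs b + 1
      ≡⟨ ℕₚ.+-comm (count Bs b) 1 ⟩
    suc (count Bs b) ∎

blocks-≤ : (π : LayeredMatching n) → All (All (_≤ n)) (blocks π)
blocks-≤ ε           = []
blocks-≤ (π ▸single) =
  ++⁺ (All.map (All.map ℕₚ.m≤n⇒m≤1+n) (blocks-≤ π)) ((ℕₚ.≤-refl ∷ []) ∷ [])
blocks-≤ (π ▸double) =
  ++⁺ (All.map (All.map (ℕₚ.m≤n⇒m≤1+n ∘ ℕₚ.m≤n⇒m≤1+n)) (blocks-≤ π))
      ((ℕₚ.n≤1+n _ ∷ ℕₚ.≤-refl ∷ []) ∷ [])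

sum-length-∷ʳ : ∀ (Bs : List (List ℕ)) B →
  sum (map length (Bs ∷ʳ B)) ≡ length B + sum (map length Bs)
sum-length-∷ʳ Bs B = begin
  sum (map length (Bs ∷ʳ B))                ≡⟨ cong sum (map-++ length Bs (B ∷ [])) ⟩
  sum (map length Bs ++ length B ∷ [])      ≡⟨ sum-++ (map length Bs) (length B ∷ []) ⟩
  sum (map length Bs) + (length B + 0)      ≡⟨ cong (λ k → sum (map length Bs) + k) (ℕₚ.+-identityʳ (length B)) ⟩
  sum (map length Bs) + length B            ≡⟨ ℕₚ.+-comm _ (length B) ⟩
  length B + sum (map length Bs)            ∎
  where open ≡.≡-Reasoning

sum-length-blocks : (π : LayeredMatching n) → sum (map length (blocks π)) ≡ n
sum-length-blocks ε           = refl
sum-length-blocks (π ▸single) =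
  ≡.trans (sum-length-∷ʳ (blocks π) _) (cong suc (sum-length-blocks π))
sum-length-blocks (π ▸double) =
  ≡.trans (sum-length-∷ʳ (blocks π) _) (cong (λ k → 2 + k) (sum-length-blocks π))

-- The blocks of `π` hold `n` elements, each at most `n`, so any appended block reaching above `n`
-- adds exactly `n` pairs, whatever its size.
rb-∷ʳ : (π : LayeredMatching n) (B : List ℕ) → n < max 0 B →
  rbList (blocks π ∷ʳ B) ≡ rb π + n
rb-∷ʳ π B n<max = ≡.trans
  (rbList-∷ʳ B (All.map (All.map (λ b≤n → ℕₚ.≤-<-trans b≤n n<max)) (blocks-≤ π)))
  (cong (λ k → rb π + k) (sum-length-blocks π))

head≤max : ∀ b bs → b ≤ max 0 (b ∷ bs)
head≤max b bs = All.head (xs≤max 0 (b ∷ bs))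

rb-single : (π : LayeredMatching n) → rb (π ▸single) ≡ rb π + n
rb-single {n} π = rb-∷ʳ π (suc n ∷ []) (head≤max (suc n) [])

rb-double : (π : LayeredMatching n) → rb (π ▸double) ≡ rb π + n
rb-double {n} π = rb-∷ʳ π (suc n ∷ suc (suc n) ∷ []) (head≤max (suc n) (suc (suc n) ∷ []))

s-single : (π : LayeredMatching n) → s (π ▸single) ≡ suc (s π)
s-single π = ≡.trans (length-filter-∷ʳ (λ B → length B ≟ 1) (blocks π) _) (ℕₚ.+-comm (s π) 1)

s-double : (π : LayeredMatching n) → s (π ▸double) ≡ s π
s-double π = ≡.trans (length-filter-∷ʳ (λ B → length B ≟ 1) (blocks π) _) (ℕₚ.+-identityʳ (s π))

d-single : (π : LayeredMatching n) → d (π ▸single) ≡ d π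
d-single π = ≡.trans (length-filter-∷ʳ (λ B → length B ≟ 2) (blocks π) _) (ℕₚ.+-identityʳ (d π))

d-double : (π : LayeredMatching n) → d (π ▸double) ≡ suc (d π)
d-double π = ≡.trans (length-filter-∷ʳ (λ B → length B ≟ 2) (blocks π) _) (ℕₚ.+-comm (d π) 1)

-- Binomial exponents, interlacing, integer indices.

C2-suc : ∀ n → suc n C 2 ≡ n + n C 2
C2-suc n = ≡.trans (≡.sym (nCk+nC[k+1]≡[n+1]C[k+1] n 1)) (cong (_+ n C 2) (nC1≡n n))

-- The difference `(c C 2) ∸ (b C 2)` serves as the sum of all i with b ≤ i < c. Monotonicity keeps
-- the truncated subtraction exact, so the difference grows by `c` when `c` becomes `suc c`.
C2-mono : ∀ {b c} → b ≤′ c → b C 2 ≤ c C 2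
C2-mono ≤′-refl           = ℕₚ.≤-refl
C2-mono (≤′-step {c} b≤c) =
  ℕₚ.≤-trans (C2-mono b≤c) (≡.subst (c C 2 ≤_) (≡.sym (C2-suc c)) (ℕₚ.m≤n+m _ c))

-- Follows the zigzag v₀ < u₂ < v₁ < u₃ < ... (indices from 0). This is what makes the first column
-- of the submatrix vanish from its third row on.
v₀<u : ∀ m (u v : Fin (2 + m) → ℕ) →
  (∀ (i : Fin (1 + m)) → u (suc i) < v (inject₁ i)) →
  (∀ (i : Fin m) → v (inject₁ (inject₁ i)) < u (suc (suc i))) →
  (i : Fin m) → v zero < u (suc (suc i))
v₀<u (suc m) u v u<v v<u zero    = v<u zero
v₀<u (suc m) u v u<v v<u (suc i) = ℕₚ.<-trans (ℕₚ.<-trans (v<u zero) (u<v (suc zero)))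
  (v₀<u m (u ∘ suc) (v ∘ suc) (u<v ∘ suc) (v<u ∘ suc) i)

n-a-c≡n⊖[a+c] : ∀ n a c → + n - + a - + c ≡ n ℤ.⊖ (a + c)
n-a-c≡n⊖[a+c] n a c = ≡.trans (ℤₚ.+-assoc (+ n) (ℤ.- + a) (ℤ.- + c))
  (≡.trans (cong (ℤ._+_ (+ n)) (≡.sym (ℤₚ.neg-distrib-+ (+ a) (+ c)))) (ℤₚ.m-n≡m⊖n n (a + c)))

module _ {c ℓ} (R : CommutativeRing c ℓ) where

  open OverRing R
  open CommutativeRing R using
    ( 0#; 1#; setoid; semiring; commutativeSemiring; +-monoid
    ; +-cong; +-congˡ; +-congʳ; *-cong; *-congˡ; *-congʳ
    ; +-identityˡ; +-identityʳ; *-identityˡ; *-identityʳ; zeroˡ; zeroʳ; distribˡ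
    ; +-assoc; -‿inverseʳ)
    renaming (_+_ to _⊕_; refl to ≈-refl; sym to ≈-sym; trans to ≈-trans; reflexive to ≈-reflexive)
  open Exp semiring using (^-homo-*)
  open MonoidSum +-monoid using () renaming (sum to ∑; sum-cong-≋ to ∑-cong; sum-replicate-zero to ∑-zero)
  open SetoidReasoning setoid
  open Solver commutativeSemiring using (solve; _:=_; _:+_; _:*_; con)

  -- The recurrence for `F`.

  foldr-map-++ : (f : A → Carrier) (xs ys : List A) →
    foldr _⊕_ 0# (map f (xs ++ ys)) ≈ foldr _⊕_ 0# (map f xs) ⊕ foldr _⊕_ 0# (map f ys)
  foldr-map-++ f []       ys = ≈-sym (+-identityˡ _)
  foldr-map-++ f (x ∷ xs) ys = ≈-trans (+-congˡ (foldr-map-++ f xs ys)) (≈-sym (+-assoc _ _ _))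

  foldr-map-* : ∀ {b} {B : Set b} (f : A → Carrier) (g : B → Carrier) (h : A → B) k →
    (∀ a → g (h a) ≈ k * f a) → (xs : List A) →
    foldr _⊕_ 0# (map g (map h xs)) ≈ k * foldr _⊕_ 0# (map f xs)
  foldr-map-* f g h k gh≈kf []       = ≈-sym (zeroʳ k)
  foldr-map-* f g h k gh≈kf (x ∷ xs) =
    ≈-trans (+-cong (gh≈kf x) (foldr-map-* f g h k gh≈kf xs)) (≈-sym (distribˡ k _ _))

  module _ (x y q : Carrier) where

    F-0 : F 0 x y q ≈ 1#
    F-0 = solve 0 (con 1 :* con 1 :* con 1 :+ con 0 := con 1) ≈-refl

    F-1 : F 1 x y q ≈ x
    F-1 = solve 1 (λ x → x :* con 1 :* con 1 :* con 1 :+ con 0 := x) ≈-refl x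

    private
      weight : LayeredMatching n → Carrier
      weight π = x ^ s π * y ^ d π * q ^ rb π

    weight-single : (π : LayeredMatching n) → weight (π ▸single) ≈ x * q ^ n * weight π
    weight-single {n} π rewrite s-single π | d-single π | rb-single π = begin
      x * x ^ s π * y ^ d π * q ^ (rb π + n)
        ≈⟨ *-congˡ (^-homo-* q (rb π) n) ⟩
      x * x ^ s π * y ^ d π * (q ^ rb π * q ^ n)
        ≈⟨ solve 5 (λ x X Y Q q → x :* X :* Y :* (Q :* q) := x :* q :* (X :* Y :* Q)) ≈-refl x _ _ _ _ ⟩
      x * q ^ n * (x ^ s π * y ^ d π * q ^ rb π) ∎

    weight-double : (π : LayeredMatching n) → weight (π ▸double) ≈ y * q ^ n * weight π
    weight-double {n} π rewrite s-double π | d-double π | rb-double π = begin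
      x ^ s π * (y * y ^ d π) * q ^ (rb π + n)
        ≈⟨ *-congˡ (^-homo-* q (rb π) n) ⟩
      x ^ s π * (y * y ^ d π) * (q ^ rb π * q ^ n)
        ≈⟨ solve 5 (λ y X Y Q q → X :* (y :* Y) :* (Q :* q) := y :* q :* (X :* Y :* Q)) ≈-refl y _ _ _ _ ⟩
      y * q ^ n * (x ^ s π * y ^ d π * q ^ rb π) ∎

    -- Splits the matchings by their last block: a singleton is appended to a matching of [n + 1], a
    -- pair to one of [n], and the size of that prefix is the exponent of `q`.
    F-suc-suc : ∀ n →
      F (suc (suc n)) x y q ≈ x * q ^ suc n * F (suc n) x y q ⊕ y * q ^ n * F n x y q
    F-suc-suc n = begin
      F (suc (suc n)) x y q
        ≈⟨ foldr-map-++ weight (map _▸single (layeredMatchings (suc n))) _ ⟩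
      foldr _⊕_ 0# (map weight (map _▸single (layeredMatchings (suc n)))) ⊕
      foldr _⊕_ 0# (map weight (map _▸double (layeredMatchings n)))
        ≈⟨ +-cong (foldr-map-* weight weight _▸single _ weight-single (layeredMatchings (suc n)))
                  (foldr-map-* weight weight _▸double _ weight-double (layeredMatchings n)) ⟩
      x * q ^ suc n * F (suc n) x y q ⊕ y * q ^ n * F n x y q ∎

  -- Entries of the infinite matrix.

  module _ (x y q : Carrier) where

    private
      G : ℕ → ℕ → Carrier
      G = FMatrix x y q

    FMatrix-≤ : ∀ {a b} → a ≤ b → G a b ≡ F (b ∸ a) (x * q ^ a) (y * q ^ a) q
    FMatrix-≤ {a} {b} a≤b with a ≤? b
    ... | yes _   = refl
    ... | no a≰b = contradiction a≤b a≰b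

    FMatrix-> : ∀ {a b} → b < a → G a b ≡ 0#
    FMatrix-> {a} {b} b<a with a ≤? b
    ... | yes a≤b = contradiction a≤b (ℕₚ.<⇒≱ b<a)
    ... | no _    = refl

    FMatrix-+ : ∀ a n → G a (n + a) ≡ F n (x * q ^ a) (y * q ^ a) q
    FMatrix-+ a n = ≡.trans (FMatrix-≤ (ℕₚ.m≤n+m a n))
      (cong (λ k → F k (x * q ^ a) (y * q ^ a) q) (ℕₚ.m+n∸n≡m n a))

    FMatrix-diagonal : ∀ a → G a a ≈ 1#
    FMatrix-diagonal a = ≈-trans (≈-reflexive (FMatrix-+ a 0)) (F-0 (x * q ^ a) (y * q ^ a) q)

    FMatrix-superdiagonal : ∀ a → G a (suc a) ≈ x * q ^ a
    FMatrix-superdiagonal a = ≈-trans (≈-reflexive (FMatrix-+ a 1)) (F-1 (x * q ^ a) (y * q ^ a) q)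

    -- The factors `q ^ a` in the arguments turn the relative exponent n into the absolute exponent
    -- n + a, so all rows solve one recurrence in the column index.
    FMatrix-suc-suc-+ : ∀ a n →
      G a (suc (suc (n + a))) ≈ x * q ^ suc (n + a) * G a (suc (n + a)) ⊕ y * q ^ (n + a) * G a (n + a)
    FMatrix-suc-suc-+ a n
      rewrite FMatrix-+ a (suc (suc n)) | FMatrix-+ a (suc n) | FMatrix-+ a n = begin
      F (suc (suc n)) X Y q
        ≈⟨ F-suc-suc X Y q n ⟩
      X * q ^ suc n * F (suc n) X Y q ⊕ Y * q ^ n * F n X Y q
        ≈⟨ solve 7 (λ x y q a n f g →
             x :* a :* (q :* n) :* f :+ y :* a :* n :* g := x :* (q :* (n :* a)) :* f :+ y :* (n :* a) :* g)
             ≈-refl x y q (q ^ a) (q ^ n) _ _ ⟩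
      x * (q * (q ^ n * q ^ a)) * F (suc n) X Y q ⊕ y * (q ^ n * q ^ a) * F n X Y q
        ≈⟨ +-cong (*-congʳ (*-congˡ (*-congˡ (^-homo-* q n a)))) (*-congʳ (*-congˡ (^-homo-* q n a))) ⟨
      x * q ^ suc (n + a) * F (suc n) X Y q ⊕ y * q ^ (n + a) * F n X Y q ∎
      where
      X Y : Carrier
      X = x * q ^ a
      Y = y * q ^ a

    -- The boundary `a = suc n` is included because the later inductions follow row `suc b` from
    -- column `b`, just before its diagonal.
    FMatrix-suc-suc : ∀ {a n} → a ≤ suc n →
      G a (suc (suc n)) ≈ x * q ^ suc n * G a (suc n) ⊕ y * q ^ n * G a n
    FMatrix-suc-suc {a} {n} a≤1+n with ℕₚ.m≤n⇒m<n∨m≡n a≤1+n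
    ... | inj₁ (s≤s a≤n) =
      ≡.subst (λ k → G a (suc (suc k)) ≈ x * q ^ suc k * G a (suc k) ⊕ y * q ^ k * G a k)
        (ℕₚ.m∸n+n≡m a≤n) (FMatrix-suc-suc-+ a (n ∸ a))
    -- Here `G (suc n) n` lies below the diagonal; its zero acts as F₋₁.
    ... | inj₂ refl = begin
      G (suc n) (suc (suc n))                              ≈⟨ FMatrix-superdiagonal (suc n) ⟩
      x * q ^ suc n                                        ≈⟨ *-identityʳ _ ⟨
      x * q ^ suc n * 1#                                   ≈⟨ *-congˡ (FMatrix-diagonal (suc n)) ⟨
      x * q ^ suc n * G (suc n) (suc n)                    ≈⟨ +-identityʳ _ ⟨
      x * q ^ suc n * G (suc n) (suc n) ⊕ 0#               ≈⟨ +-congˡ (zeroʳ _) ⟨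
      x * q ^ suc n * G (suc n) (suc n) ⊕ y * q ^ n * 0#
        ≈⟨ +-congˡ (*-congˡ (≈-reflexive (FMatrix-> (ℕₚ.n<1+n n)))) ⟨
      x * q ^ suc n * G (suc n) (suc n) ⊕ y * q ^ n * G (suc n) n ∎

    -- Casorati determinants and Euler's identity.

    -- The product of − y qⁱ over b ≤ i < c.
    doubleWeights : ℕ → ℕ → Carrier
    doubleWeights b c = (- y) ^ (c ∸ b) * q ^ ((c C 2) ∸ (b C 2))

    doubleWeights-diagonal : ∀ b → doubleWeights b b ≈ 1#
    doubleWeights-diagonal b rewrite ℕₚ.n∸n≡0 b | ℕₚ.n∸n≡0 (b C 2) = *-identityˡ 1#

    doubleWeights-suc : ∀ {b c} → b ≤′ c →
      doubleWeights b (suc c) ≈ - y * q ^ c * doubleWeights b c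
    doubleWeights-suc {b} {c} b≤c
      rewrite C2-suc c | ℕₚ.+-∸-assoc 1 (ℕₚ.≤′⇒≤ b≤c) | ℕₚ.+-∸-assoc c (C2-mono b≤c) = begin
      - y * Y * q ^ (c + e)      ≈⟨ *-congˡ (^-homo-* q c e) ⟩
      - y * Y * (q ^ c * q ^ e)  ≈⟨ solve 4 (λ z Y c e → z :* Y :* (c :* e) := z :* c :* (Y :* e)) ≈-refl (- y) _ _ _ ⟩
      - y * q ^ c * (Y * q ^ e)  ∎
      where
      e = (c C 2) ∸ (b C 2)
      Y = (- y) ^ (c ∸ b)

    -- The solver works over commutative semirings and sees `- y` as an independent atom, so this
    -- cancellation is supplied by hand.
    doubleWeight-cancel : ∀ n k → y * q ^ n * k ⊕ - y * q ^ n * k ≈ 0#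
    doubleWeight-cancel n k = begin
      y * q ^ n * k ⊕ - y * q ^ n * k
        ≈⟨ solve 4 (λ y z Q k → y :* Q :* k :+ z :* Q :* k := (y :+ z) :* (Q :* k)) ≈-refl y (- y) _ k ⟩
      (y ⊕ - y) * (q ^ n * k)          ≈⟨ *-congʳ (-‿inverseʳ y) ⟩
      0# * (q ^ n * k)                 ≈⟨ zeroˡ _ ⟩
      0#                               ∎

    -- The Casorati determinant of the solutions in rows `a` and `suc b`, with its negative term
    -- moved to the right. It equals `G a b` at `c = b`, and each step multiplies it by - y qᶜ, the
    -- determinant of the transfer matrix. This is Euler's identity for `d = suc c`.
    casorati : ∀ {a b c} → a ≤ b → b ≤′ c →
      G a c * G (suc b) (suc c) ≈ G (suc b) c * G a (suc c) ⊕ doubleWeights b c * G a b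
    casorati {a} {b} a≤b ≤′-refl = begin
      G a b * G (suc b) (suc b)   ≈⟨ *-congˡ (FMatrix-diagonal (suc b)) ⟩
      G a b * 1#                  ≈⟨ solve 2 (λ g h → g :* con 1 := con 0 :* h :+ con 1 :* g) ≈-refl (G a b) _ ⟩
      0# * G a (suc b) ⊕ 1# * G a b
        ≈⟨ +-cong (*-congʳ (≈-reflexive (FMatrix-> (ℕₚ.n<1+n b)))) (*-congʳ (doubleWeights-diagonal b)) ⟨
      G (suc b) b * G a (suc b) ⊕ doubleWeights b b * G a b ∎
    casorati {a} {b} a≤b (≤′-step {c} b≤c) = begin
      A₁ * G (suc b) (suc (suc c))
        ≈⟨ *-congˡ (FMatrix-suc-suc (s≤s (ℕₚ.≤′⇒≤ b≤c))) ⟩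
      A₁ * (t * B₁ ⊕ w * B₀)
        ≈⟨ solve 5 (λ a t b w b₀ → a :* (t :* b :+ w :* b₀) := t :* a :* b :+ w :* (b₀ :* a)) ≈-refl A₁ t B₁ w B₀ ⟩
      t * A₁ * B₁ ⊕ w * (B₀ * A₁)
        ≈⟨ +-identityʳ _ ⟨
      t * A₁ * B₁ ⊕ w * (B₀ * A₁) ⊕ 0#
        -- Of the inserted zero, `w * K` completes `w * (B₀ * A₁)` to the right side of the
        -- induction hypothesis, and `w′ * K` becomes the new last term.
        ≈⟨ +-congˡ (doubleWeight-cancel c K) ⟨
      t * A₁ * B₁ ⊕ w * (B₀ * A₁) ⊕ (w * K ⊕ w′ * K)
        ≈⟨ solve 7 (λ t a b w m k w′ → t :* a :* b :+ w :* m :+ (w :* k :+ w′ :* k)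
             := t :* a :* b :+ w :* (m :+ k) :+ w′ :* k) ≈-refl t A₁ B₁ w (B₀ * A₁) K w′ ⟩
      t * A₁ * B₁ ⊕ w * (B₀ * A₁ ⊕ K) ⊕ w′ * K
        ≈⟨ +-congʳ (+-congˡ (*-congˡ (casorati a≤b b≤c))) ⟨
      t * A₁ * B₁ ⊕ w * (A₀ * B₁) ⊕ w′ * K
        ≈⟨ solve 8 (λ t a b w a₀ w′ k g → t :* a :* b :+ w :* (a₀ :* b) :+ w′ :* (k :* g)
             := b :* (t :* a :+ w :* a₀) :+ w′ :* k :* g) ≈-refl t A₁ B₁ w A₀ w′ (doubleWeights b c) (G a b) ⟩
      B₁ * (t * A₁ ⊕ w * A₀) ⊕ w′ * doubleWeights b c * G a b
        ≈⟨ +-cong (*-congˡ (FMatrix-suc-suc (ℕₚ.m≤n⇒m≤1+n (ℕₚ.≤-trans a≤b (ℕₚ.≤′⇒≤ b≤c)))))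
                  (*-congʳ (doubleWeights-suc b≤c)) ⟨
      B₁ * G a (suc (suc c)) ⊕ doubleWeights b (suc c) * G a b ∎
      where
      t  = x * q ^ suc c
      w  = y * q ^ c
      w′ = - y * q ^ c
      A₀ = G a c
      A₁ = G a (suc c)
      B₀ = G (suc b) c
      B₁ = G (suc b) (suc c)
      K  = doubleWeights b c * G a b

    private
      -- The middle row is written `suc b` to avoid the predecessor b - 1.
      Euler : (a b c d : ℕ) → Set ℓ
      Euler a b c d =
        G a c * G (suc b) d ≈ G (suc b) c * G a d ⊕ doubleWeights b c * (G a b * G (suc c) d)

    -- As functions of d, both sides satisfy the recurrence of FMatrix-suc-suc.
    euler′ : ∀ {a b c d} → a ≤ b → b ≤′ c → c ≤′ d → Euler a b c d × Euler a b c (suc d)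
    -- The recurrence has order two, so two consecutive values of `d` are carried: at `d = c` the
    -- entry `G (suc c) c` is zero, and at `d = suc c` the claim is `casorati`.
    euler′ {a} {b} {c} a≤b b≤c ≤′-refl = at-c , at-suc-c
      where
      at-c : Euler a b c c
      at-c = begin
        G a c * G (suc b) c
          ≈⟨ solve 4 (λ a b k g → a :* b := b :* a :+ k :* (g :* con 0)) ≈-refl (G a c) _ (doubleWeights b c) (G a b) ⟩
        G (suc b) c * G a c ⊕ doubleWeights b c * (G a b * 0#)
          ≈⟨ +-congˡ (*-congˡ (*-congˡ (≈-reflexive (FMatrix-> (ℕₚ.n<1+n c))))) ⟨
        G (suc b) c * G a c ⊕ doubleWeights b c * (G a b * G (suc c) c) ∎
      at-suc-c : Euler a b c (suc c)
      at-suc-c = begin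
        G a c * G (suc b) (suc c)
          ≈⟨ casorati a≤b b≤c ⟩
        G (suc b) c * G a (suc c) ⊕ doubleWeights b c * G a b
          ≈⟨ +-congˡ (*-congˡ (*-identityʳ _)) ⟨
        G (suc b) c * G a (suc c) ⊕ doubleWeights b c * (G a b * 1#)
          ≈⟨ +-congˡ (*-congˡ (*-congˡ (FMatrix-diagonal (suc c)))) ⟨
        G (suc b) c * G a (suc c) ⊕ doubleWeights b c * (G a b * G (suc c) (suc c)) ∎
    euler′ {a} {b} {c} a≤b b≤c (≤′-step {d} c≤d) with euler′ a≤b b≤c c≤d
    ... | at-d , at-suc-d = at-suc-d , (begin
      P * G (suc b) (suc (suc d))
        ≈⟨ *-congˡ (FMatrix-suc-suc (s≤s b≤d)) ⟩
      P * (t * G (suc b) (suc d) ⊕ w * G (suc b) d)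
        ≈⟨ solve 5 (λ P t g w h → P :* (t :* g :+ w :* h) := t :* (P :* g) :+ w :* (P :* h)) ≈-refl P t _ w _ ⟩
      t * (P * G (suc b) (suc d)) ⊕ w * (P * G (suc b) d)
        ≈⟨ +-cong (*-congˡ at-suc-d) (*-congˡ at-d) ⟩
      t * (Q * G a (suc d) ⊕ K * (H * G (suc c) (suc d))) ⊕ w * (Q * G a d ⊕ K * (H * G (suc c) d))
        ≈⟨ solve 9 (λ t Q g K H h w g₀ h₀ →
             t :* (Q :* g :+ K :* (H :* h)) :+ w :* (Q :* g₀ :+ K :* (H :* h₀))
             := Q :* (t :* g :+ w :* g₀) :+ K :* (H :* (t :* h :+ w :* h₀)))
             ≈-refl t Q _ K H _ w _ _ ⟩
      Q * (t * G a (suc d) ⊕ w * G a d) ⊕ K * (H * (t * G (suc c) (suc d) ⊕ w * G (suc c) d))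
        ≈⟨ +-cong (*-congˡ (FMatrix-suc-suc (ℕₚ.m≤n⇒m≤1+n (ℕₚ.≤-trans a≤b b≤d))))
                  (*-congˡ (*-congˡ (FMatrix-suc-suc (s≤s (ℕₚ.≤′⇒≤ c≤d))))) ⟨
      Q * G a (suc (suc d)) ⊕ K * (H * G (suc c) (suc (suc d))) ∎)
      where
      b≤d = ℕₚ.≤-trans (ℕₚ.≤′⇒≤ b≤c) (ℕₚ.≤′⇒≤ c≤d)
      t = x * q ^ suc d
      w = y * q ^ d
      P = G a c
      Q = G (suc b) c
      K = doubleWeights b c
      H = G a b

    -- Shifts the middle row back by one. Since `b ≤ c`, the exponent `(c ∸ b) + 1` is c - (b - 1),
    -- in the form summed in the theorem.
    euler : ∀ {a b c d} → a < b → b ≤ c → c ≤ d →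
      G a c * G b d ≈ G b c * G a d ⊕
        (- y) ^ ((c ∸ b) + 1) * q ^ ((c C 2) ∸ ((b ∸ 1) C 2)) * (G a (b ∸ 1) * G (c + 1) d)
    euler {a} {suc b} {c} {d} (s≤s a≤b) b<c c≤d
      rewrite ℕₚ.+-comm c 1 | ≡.sym (ℕₚ.+-∸-comm 1 b<c) | ℕₚ.+-comm c 1 =
      proj₁ (euler′ a≤b (ℕₚ.≤⇒≤′ (ℕₚ.<⇒≤ b<c)) (ℕₚ.≤⇒≤′ c≤d))

    -- Integer-indexed `F` as matrix entries.

    Fℤ-⊖ : ∀ n b → Fℤ (n ℤ.⊖ b) (x * q ^ b) (y * q ^ b) q ≡ G b n
    Fℤ-⊖ n b with b ≤? n
    ... | yes b≤n rewrite ℤₚ.⊖-≥ b≤n = refl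
    -- Positivity of `b ∸ n` forces the constructor `-[1+_]`, whose value 0 agrees with the zero
    -- below the diagonal; this covers F₋₁ = 0.
    ... | no  b≰n rewrite ℤₚ.⊖-< (ℕₚ.≰⇒> b≰n) with b ∸ n | ℕₚ.m<n⇒0<n∸m (ℕₚ.≰⇒> b≰n)
    ...   | suc _ | _ = refl

    Fℤ-+ : ∀ n a c → Fℤ (+ n - + a - + c) (x * q ^ (a + c)) (y * q ^ (a + c)) q ≡ G (a + c) n
    Fℤ-+ n a c = ≡.trans (cong (λ i → Fℤ i _ _ q) (n-a-c≡n⊖[a+c] n a c)) (Fℤ-⊖ n (a + c))

    -- The index subtracts one more than the shift `a + c`, which moves the column to `n ∸ 1`;
    -- `0 < n` makes this predecessor exact.
    Fℤ-pred : ∀ {n} a c → 0 < n →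
      Fℤ (+ n - + a - + suc c) (x * q ^ (a + c)) (y * q ^ (a + c)) q ≡ G (a + c) (n ∸ 1)
    Fℤ-pred {suc n} a c _ = ≡.trans (cong (λ i → Fℤ i _ _ q) shift) (Fℤ-⊖ n (a + c))
      where
      shift : + suc n - + a - + suc c ≡ n ℤ.⊖ (a + c)
      shift = ≡.trans (n-a-c≡n⊖[a+c] (suc n) a (suc c))
        (≡.trans (cong (suc n ℤ.⊖_) (ℕₚ.+-suc a c)) (ℤₚ.[1+m]⊖[1+n]≡m⊖n n (a + c)))

  -- Laplace expansion and the determinant of the submatrix.

  det-two-entries : ∀ {n} (M : Matrix (2 + n)) → (∀ i → M (suc (suc i)) zero ≈ 0#) →
    det M ≈ M zero zero * det (λ r c → M (suc r) (suc c))
      ⊕ - 1# * (M (suc zero) zero * det (λ r c → M (punchIn (suc zero) r) (suc c)))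
  det-two-entries {n} M M≈0 = begin
    1# * M₀ * D₀ ⊕ (- 1# * 1# * M₁ * D₁ ⊕ ∑ rest)
      ≈⟨ +-congˡ (+-congˡ (≈-trans (∑-cong rest≈0) (∑-zero n))) ⟩
    1# * M₀ * D₀ ⊕ (- 1# * 1# * M₁ * D₁ ⊕ 0#)
      ≈⟨ solve 5 (λ z a b c d → con 1 :* a :* b :+ (z :* con 1 :* c :* d :+ con 0)
           := a :* b :+ z :* (c :* d)) ≈-refl (- 1#) M₀ D₀ M₁ D₁ ⟩
    M₀ * D₀ ⊕ - 1# * (M₁ * D₁) ∎
    where
    M₀ = M zero zero
    M₁ = M (suc zero) zero
    D₀ = det (λ r c → M (suc r) (suc c))
    D₁ = det (λ r c → M (punchIn (suc zero) r) (suc c))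
    rest : Fin n → Carrier
    rest i = (- 1#) ^ toℕ (suc (suc i)) * M (suc (suc i)) zero *
      det (λ r c → M (punchIn (suc (suc i)) r) (suc c))
    rest≈0 : ∀ i → rest i ≈ 0#
    rest≈0 i = begin
      rest i                    ≈⟨ *-congʳ (*-congˡ (M≈0 i)) ⟩
      _ * 0# * _                ≈⟨ *-congʳ (zeroʳ _) ⟩
      0# * _                    ≈⟨ zeroˡ _ ⟩
      0#                        ∎

  det-1×1 : (M : Matrix 1) → det M ≈ M zero zero
  det-1×1 M = solve 1 (λ a → con 1 :* a :* con 1 :+ con 0 := a) ≈-refl (M zero zero)

  -- Combines the two Laplace terms: `p` and `s` are the first-column entries, `X` the common part
  -- of the minors, `r` and `t` the factors in which these differ. The hypothesis has the
  -- subtraction-free shape of `euler`.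
  difference-of-products : ∀ {p r s t k} X → p * r ≈ s * t ⊕ k →
    p * (X * r) ⊕ - 1# * (s * (X * t)) ≈ X * k
  difference-of-products {p} {r} {s} {t} {k} X pr≈st+k = begin
    p * (X * r) ⊕ - 1# * (s * (X * t))
      ≈⟨ solve 6 (λ p X r z s t → p :* (X :* r) :+ z :* (s :* (X :* t))
           := X :* (p :* r) :+ z :* (X :* (s :* t))) ≈-refl p X r (- 1#) s t ⟩
    X * (p * r) ⊕ - 1# * (X * (s * t))
      ≈⟨ +-congʳ (*-congˡ pr≈st+k) ⟩
    X * (s * t ⊕ k) ⊕ - 1# * (X * (s * t))
      ≈⟨ solve 4 (λ X z m k → X :* (m :+ k) :+ z :* (X :* m)
           := X :* k :+ (con 1 :+ z) :* (X :* m)) ≈-refl X (- 1#) (s * t) k ⟩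
    X * k ⊕ (1# ⊕ - 1#) * (X * (s * t))
      ≈⟨ +-congˡ (*-congʳ (-‿inverseʳ 1#)) ⟩
    X * k ⊕ 0# * (X * (s * t))
      ≈⟨ solve 2 (λ k m → k :+ con 0 :* m := k) ≈-refl (X * k) (X * (s * t)) ⟩
    X * k ∎

  module _ (x y q : Carrier) where

    private
      G : ℕ → ℕ → Carrier
      G = FMatrix x y q

    -- Stated with matrix entries only, so that `euler` applies directly. On the right, `u zero`
    -- occurs in just one factor, so minors differing only in their first row share all the others.
    det-FSubmatrix : (m : ℕ) (u v : Fin (2 + m) → ℕ) →
      u zero < u (suc zero) →
      (∀ (i : Fin (1 + m)) → u (suc i) < v (inject₁ i)) →
      (∀ (i : Fin m) → v (inject₁ (inject₁ i)) < u (suc (suc i))) →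
      v (inject₁ (fromℕ m)) < v (suc (fromℕ m)) →
      det (FSubmatrix x y q u v)
        ≈ (- y) ^ (∑[ i < 1 + m ] ((v (inject₁ i) ∸ u (suc i)) + 1))
          * q ^ (∑[ i < 1 + m ] ((v (inject₁ i) C 2) ∸ ((u (suc i) ∸ 1) C 2)))
          * G (u zero) (u (suc zero) ∸ 1)
          * G (v (inject₁ (fromℕ m)) + 1) (v (suc (fromℕ m)))
          * ∏ (λ (i : Fin m) → G (v (inject₁ (inject₁ i)) + 1) (u (suc (suc i)) ∸ 1))
    det-FSubmatrix zero u v u₀<u₁ u<v v<u v<v = begin
      det (FSubmatrix x y q u v)
        ≈⟨ det-two-entries (FSubmatrix x y q u v) (λ ()) ⟩
      G u₀ v₀ * det (λ r c → G (u (suc r)) (v (suc c))) ⊕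
        - 1# * (G u₁ v₀ * det (λ r c → G (u (punchIn (suc zero) r)) (v (suc c))))
        ≈⟨ +-cong (*-congˡ (minor≈ (u ∘ suc))) (*-congˡ (*-congˡ (minor≈ (u ∘ punchIn (suc zero))))) ⟩
      G u₀ v₀ * (1# * G u₁ v₁) ⊕ - 1# * (G u₁ v₀ * (1# * G u₀ v₁))
        -- For k = 2 the determinant is Euler's identity itself, with common factor `1#`.
        ≈⟨ difference-of-products 1# (euler x y q u₀<u₁ (ℕₚ.<⇒≤ (u<v zero)) (ℕₚ.<⇒≤ v<v)) ⟩
      1# * ((- y) ^ N * q ^ B * (G u₀ (u₁ ∸ 1) * G (v₀ + 1) v₁))
        ≈⟨ solve 4 (λ Y Q g h → con 1 :* (Y :* Q :* (g :* h)) := Y :* Q :* g :* h :* con 1) ≈-refl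
             ((- y) ^ N) (q ^ B) _ _ ⟩
      (- y) ^ N * q ^ B * G u₀ (u₁ ∸ 1) * G (v₀ + 1) v₁ * 1#
        ≈⟨ *-congʳ (*-congʳ (*-congʳ (*-cong (≈-reflexive (cong ((- y) ^_) (ℕₚ.+-identityʳ N)))
                                             (≈-reflexive (cong (q ^_) (ℕₚ.+-identityʳ B)))))) ⟨
      (- y) ^ (N + 0) * q ^ (B + 0) * G u₀ (u₁ ∸ 1) * G (v₀ + 1) v₁ * 1# ∎
      where
      u₀ = u zero
      u₁ = u (suc zero)
      v₀ = v zero
      v₁ = v (suc zero)
      N = (v₀ ∸ u₁) + 1
      B = (v₀ C 2) ∸ ((u₁ ∸ 1) C 2)
      minor≈ : (w : Fin 1 → ℕ) → det (λ r c → G (w r) (v (suc c))) ≈ 1# * G (w zero) v₁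
      minor≈ w = ≈-trans (det-1×1 (λ r c → G (w r) (v (suc c)))) (≈-sym (*-identityˡ _))
    det-FSubmatrix (suc m) u v u₀<u₁ u<v v<u v<v = begin
      det (FSubmatrix x y q u v)
        ≈⟨ det-two-entries (FSubmatrix x y q u v)
             (λ i → ≈-reflexive (FMatrix-> x y q (v₀<u (suc m) u v u<v v<u i))) ⟩
      G u₀ v₀ * det (FSubmatrix x y q (u ∘ suc) (v ∘ suc)) ⊕
        - 1# * (G u₁ v₀ * det (FSubmatrix x y q (u ∘ punchIn (suc zero)) (v ∘ suc)))
        ≈⟨ +-cong (*-congˡ (≈-trans (det-FSubmatrix m (u ∘ suc) (v ∘ suc) u₁<u₂ (u<v ∘ suc) (v<u ∘ suc) v<v)
                                    (X-last (G u₁ e))))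
                  -- Compared with the other minor only the first row changes, so only the first
                  -- hypothesis needs a new proof, namely u₀ < u₂.
                  (*-congˡ (*-congˡ (≈-trans
                    (det-FSubmatrix m (u ∘ punchIn (suc zero)) (v ∘ suc) (ℕₚ.<-trans u₀<u₁ u₁<u₂)
                      (u<v ∘ suc) (v<u ∘ suc) v<v)
                    (X-last (G u₀ e))))) ⟩
      G u₀ v₀ * (X * G u₁ e) ⊕ - 1# * (G u₁ v₀ * (X * G u₀ e))
        ≈⟨ difference-of-products X
             (euler x y q u₀<u₁ (ℕₚ.<⇒≤ (u<v zero)) (ℕₚ.<⇒≤pred (v<u zero))) ⟩
      X * ((- y) ^ N₀ * q ^ B₀ * (G u₀ (u₁ ∸ 1) * G (v₀ + 1) e))
        -- `G (v₀ + 1) e` becomes the first factor of the product, and `N₀` and `B₀` the first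
        -- summands of the exponents.
        ≈⟨ solve 8 (λ Y Q L P Y₀ Q₀ g h →
             Y :* Q :* L :* P :* (Y₀ :* Q₀ :* (g :* h)) := Y₀ :* Y :* (Q₀ :* Q) :* g :* L :* (h :* P))
             ≈-refl ((- y) ^ N) (q ^ B) L P ((- y) ^ N₀) (q ^ B₀) _ _ ⟩
      (- y) ^ N₀ * (- y) ^ N * (q ^ B₀ * q ^ B) * G u₀ (u₁ ∸ 1) * L * (G (v₀ + 1) e * P)
        ≈⟨ *-congʳ (*-congʳ (*-congʳ (*-cong (^-homo-* (- y) N₀ N) (^-homo-* q B₀ B)))) ⟨
      (- y) ^ (N₀ + N) * q ^ (B₀ + B) * G u₀ (u₁ ∸ 1) * L * (G (v₀ + 1) e * P) ∎
      where
      u₀ = u zero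
      u₁ = u (suc zero)
      v₀ = v zero
      e  = u (suc (suc zero)) ∸ 1
      N₀ = (v₀ ∸ u₁) + 1
      B₀ = (v₀ C 2) ∸ ((u₁ ∸ 1) C 2)
      N  = ∑[ i < 1 + m ] ((v (inject₁ (suc i)) ∸ u (suc (suc i))) + 1)
      B  = ∑[ i < 1 + m ] ((v (inject₁ (suc i)) C 2) ∸ ((u (suc (suc i)) ∸ 1) C 2))
      L  = G (v (inject₁ (fromℕ (suc m))) + 1) (v (suc (fromℕ (suc m))))
      P  = ∏ (λ (i : Fin m) → G (v (inject₁ (inject₁ (suc i))) + 1) (u (suc (suc (suc i))) ∸ 1))
      X  = (- y) ^ N * q ^ B * L * P
      u₁<u₂ : u₁ < u (suc (suc zero))
      u₁<u₂ = ℕₚ.<-trans (u<v zero) (v<u zero)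
      X-last : ∀ g → (- y) ^ N * q ^ B * g * L * P ≈ X * g
      X-last g = solve 5 (λ Y Q L P g → Y :* Q :* g :* L :* P := Y :* Q :* L :* P :* g)
        ≈-refl ((- y) ^ N) (q ^ B) L P g

-- Translation from matrix entries back to `F`.

theorem5p4 : ∀ {c ℓ} (R : CommutativeRing c ℓ) →
    let open OverRing R in
    (x y q : Carrier) (m : ℕ) (u v : Fin (2 + m) → ℕ) →
    u zero < u (suc zero) →
    (∀ (i : Fin (1 + m)) → u (suc i) < v (inject₁ i)) →
    (∀ (i : Fin m) → v (inject₁ (inject₁ i)) < u (suc (suc i))) →
    v (inject₁ (fromℕ m)) < v (suc (fromℕ m)) →
    det (FSubmatrix x y q u v)
    ≈ (- y) ^ (∑[ i < 1 + m ] ((v (inject₁ i) ∸ u (suc i)) + 1))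
    * q ^ (∑[ i < 1 + m ] ((v (inject₁ i) C 2) ∸ ((u (suc i) ∸ 1) C 2)))
    * Fℤ (+ u (suc zero) - + u zero - + 1)
    (x * q ^ u zero) (y * q ^ u zero) q
    * Fℤ (+ v (suc (fromℕ m)) - + v (inject₁ (fromℕ m)) - + 1)
    (x * q ^ (v (inject₁ (fromℕ m)) + 1)) (y * q ^ (v (inject₁ (fromℕ m)) + 1)) q
    * ∏ (λ (i : Fin m) →
    Fℤ (+ u (suc (suc i)) - + v (inject₁ (inject₁ i)) - + 2)
    (x * q ^ (v (inject₁ (inject₁ i)) + 1)) (y * q ^ (v (inject₁ (inject₁ i)) + 1)) q)
theorem5p4 R x y q m u v u₀<u₁ u<v v<u v<v = ≈-trans
  (det-FSubmatrix R x y q m u v u₀<u₁ u<v v<u v<v)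
  (*-cong (*-cong (*-congˡ first) last) (∏-cong middle))
  where
  open OverRing R
  open CommutativeRing R using (*-cong; *-congˡ; *-monoid)
    renaming (trans to ≈-trans; reflexive to ≈-reflexive)
  open MonoidSum *-monoid using () renaming (sum-cong-≋ to ∏-cong)
  -- `Fℤ-pred` with `c = 0` speaks of row `u zero + 0`, which does not reduce, so both ends are
  -- rewritten.
  first = ≈-reflexive (≡.sym (≡.trans
    (cong (λ a → Fℤ (+ u (suc zero) - + u zero - + 1) (x * q ^ a) (y * q ^ a) q) (≡.sym (ℕₚ.+-identityʳ (u zero))))
    (≡.trans (Fℤ-pred R x y q (u zero) 0 (ℕₚ.≤-<-trans z≤n u₀<u₁))
      (cong (λ a → FMatrix x y q a (u (suc zero) ∸ 1)) (ℕₚ.+-identityʳ (u zero))))))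
  -- The column is the last `v` itself, so index and shift agree without a predecessor.
  last = ≈-reflexive (≡.sym (Fℤ-+ R x y q (v (suc (fromℕ m))) (v (inject₁ (fromℕ m))) 1))
  middle = λ i → ≈-reflexive (≡.sym (Fℤ-pred R x y q (v (inject₁ (inject₁ i))) 1
    (ℕₚ.≤-<-trans z≤n (v<u i))))
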